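{- Let $W$ be a normal PO-dilator and let $(\mathcal T^0W,\iota^0,\kappa^0)$ and $(\mathcal T^1W,\iota^1,\kappa^1)$ be two Kruskal derivatives of $W$. Then there is a natural isomorphism $\eta:\mathcal T^0W\Rightarrow\mathcal T^1W$ (of functors on the category of partial orders and quasi embeddings) such that $\eta_X\circ\iota^0_X=\iota^1_X$ and $\eta_X\circ\kappa^0_X=\kappa^1_X\circ W(\eta_X)$ for every partial order $X$.
   Context: A quasi embedding between partial orders $X,Y$ is a function $f$ with $f(x)\leq_Y f(y)\Rightarrow x\leq_X y$; an embedding also satisfies the converse. $\mathrm{PO}$ is the category of partial orders and quasi embeddings. $[X]^{<\omega}$ denotes the finite subsets of $X$, with $[f]^{<\omega}(a)=\{f(x)\mid x\in a\}$. A PO-dilator is a functor $W:\mathrm{PO}\to\mathrm{PO}$ mapping embeddings to embeddings, with a natural transformation $\operatorname{supp}^W:W\Rightarrow[\cdot]^{<\omega}$ such that for every embedding $f:X\to Y$, $\operatorname{rng}(W(f))=\{\sigma\in W(Y)\mid\operatorname{supp}^W_Y(\sigma)\subseteq\operatorname{rng}(f)\}$. For finite $a,b\subseteq X$, $a\leq^{\mathrm{fin}}_X b$ iff every $x\in a$ has some $y\in b$ with $x\leq_X y$ ($z\leq^{\mathrm{fin}}_X b$ means $\{z\}\leq^{\mathrm{fin}}_X b$). $W$ is normal if $\sigma\leq_{W(X)}\tau$ implies $\operatorname{supp}^W_X(\sigma)\leq^{\mathrm{fin}}_X\operatorname{supp}^W_X(\tau)$. A Kruskal fixed point of $W$ over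 a partial order $X$ is a partial order $Z$ with functions $\iota:X\to Z$, $\kappa:W(Z)\to Z$ such that $\operatorname{rng}(\iota)\cap\operatorname{rng}(\kappa)=\emptyset$ and, for all $x,y\in X$, $\sigma,\tau\in W(Z)$: $\iota(x)\leq_Z\iota(y)\Rightarrow x\leq_X y$; $\iota(x)\leq_Z\kappa(\tau)$ iff $\iota(x)\leq^{\mathrm{fin}}_Z\operatorname{supp}^W_Z(\tau)$; $\kappa(\sigma)\not\leq_Z\iota(y)$; $\kappa(\sigma)\leq_Z\kappa(\tau)$ iff ($\sigma\leq_{W(Z)}\tau$ or $\kappa(\sigma)\leq^{\mathrm{fin}}_Z\operatorname{supp}^W_Z(\tau)$). It is initial if for every Kruskal fixed point $(Z',\iota',\kappa')$ of $W$ over $X$ there is a unique quasi embedding $f:Z\to Z'$ with $f\circ\iota=\iota'$ and $f\circ\kappa=\kappa'\circ W(f)$. A Kruskal derivative of a normal PO-dilator $W$ is a tuple $(\mathcal T W,\iota,\kappa)$ consisting of a normal PO-dilator $\mathcal T W$ and families of functions $\iota_X:X\to\mathcal T W(X)$, $\kappa_X:W(\mathcal T W(X))\to\mathcal T W(X)$ indexed by partial orders $X$ such that (i) $(\mathcal T W(X),\iota_X,\kappa_X)$ is an initial Kruskal fixed point of $W$ over $X$ for each $X$, and (ii) $\iota_Y\circ f=\mathcal T W(f)\circ\iota_X$ and $\mathcal T W(f)\circ\kappa_X=\kappa_Y\circ W(\mathcal T W(f))$ for every quasi embedding $f:X\to Y$. -}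

module Defs where

open import Data.List.Base using (List; [_]; map)
import Data.List.Membership.Setoid as Membership
import Data.List.Relation.Binary.Subset.Setoid as Subset
open import Data.List.Relation.Binary.Subset.Setoid.Properties
  using (⊆-refl; ⊆-trans; map⁺)
open import Data.List.Relation.Unary.All using (All)
open import Data.List.Relation.Unary.Any using (Any)
open import Data.Product using (∃; ∃!; _×_; _,_; swap)
open import Data.Sum.Base using (_⊎_)
open import Function.Base using (id; _∘_)
open import Function.Bundles using (Func; _⟨$⟩_; _⇔_)
import Function.Construct.Composition as Composition
import Function.Construct.Identity as Identity
import Function.Relation.Binary.Setoid.Equality as FuncEquality
open import Level using (Level; _⊔_; suc)
open import Relation.Binary.Bundles using (Setoid; Poset)
open import Relation.Nullary using (¬_)
open import Relation.Unary using (Pred; _⊆_; _≐_; _∩_; ∅)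

-- Partial orders are stdlib posets, so equality of elements is the equivalence
-- _≈_ carried by the poset: functions respect it, and functions are compared
-- pointwise up to it.

module _ {a ℓ a′ ℓ′} {A : Setoid a ℓ} {B : Setoid a′ ℓ′} where

  infix 4 _≗_
  _≗_ : Func A B → Func A B → Set (a ⊔ ℓ′)
  _≗_ = FuncEquality._≈_ A B

  rng : Func A B → Pred (Setoid.Carrier B) (a ⊔ ℓ′)
  rng f y = ∃ λ x → Setoid._≈_ B (f ⟨$⟩ x) y

infixr 9 _∘ᶠ_
_∘ᶠ_ : ∀ {a ℓ a′ ℓ′ a″ ℓ″} {A : Setoid a ℓ} {B : Setoid a′ ℓ′} {C : Setoid a″ ℓ″} →
       Func B C → Func A B → Func A C
g ∘ᶠ f = Composition.function f g

-- A finite subset is given by a list of its elements; lists with the same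
-- members (up to _≈_) are equal.

[_]^<ω : ∀ {a ℓ} → Setoid a ℓ → Setoid a (a ⊔ ℓ)
[ A ]^<ω = record
  { Carrier       = List (Setoid.Carrier A)
  ; _≈_           = λ a b → a ⊆ᴬ b × b ⊆ᴬ a
  ; isEquivalence = record
    { refl  = ⊆-refl A , ⊆-refl A
    ; sym   = swap
    ; trans = λ (p , p′) (q , q′) → ⊆-trans A p q , ⊆-trans A q′ p′
    }
  }
  where open Subset A using () renaming (_⊆_ to _⊆ᴬ_)

map^<ω : ∀ {a ℓ a′ ℓ′} {A : Setoid a ℓ} {B : Setoid a′ ℓ′} →
         Func A B → Func [ A ]^<ω [ B ]^<ω
map^<ω {A = A} {B = B} f = record
  { to   = map (f ⟨$⟩_)
  ; cong = λ (p , q) → map⁺ A B (Func.cong f) p , map⁺ A B (Func.cong f) q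
  }

module _ {c ℓ₁ ℓ₂ : Level} where

  ∣_∣ : Poset c ℓ₁ ℓ₂ → Setoid c ℓ₁
  ∣_∣ = Poset.Eq.setoid

  FinLE : (X : Poset c ℓ₁ ℓ₂) → List (Poset.Carrier X) → List (Poset.Carrier X) →
          Set (c ⊔ ℓ₂)
  FinLE X a b = All (λ x → Any (λ y → x ≤ y) b) a
    where open Poset X using (_≤_)

  syntax FinLE X a b = a ≤fin[ X ] b

  record QuasiEmbedding (X Y : Poset c ℓ₁ ℓ₂) : Set (c ⊔ ℓ₁ ⊔ ℓ₂) where
    private
      module X = Poset X
      module Y = Poset Y
    field
      func     : Func ∣ X ∣ ∣ Y ∣
      reflects : ∀ {x y} → (func ⟨$⟩ x) Y.≤ (func ⟨$⟩ y) → x X.≤ y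

  open QuasiEmbedding public using (func)

  IsEmbedding : {X Y : Poset c ℓ₁ ℓ₂} → QuasiEmbedding X Y → Set (c ⊔ ℓ₂)
  IsEmbedding {X} {Y} f = ∀ {x y} → x X.≤ y → (func f ⟨$⟩ x) Y.≤ (func f ⟨$⟩ y)
    where
      module X = Poset X
      module Y = Poset Y

  idᵠ : {X : Poset c ℓ₁ ℓ₂} → QuasiEmbedding X X
  idᵠ {X} = record { func = Identity.function ∣ X ∣ ; reflects = id }

  infixr 9 _∘ᵠ_
  _∘ᵠ_ : {X Y Z : Poset c ℓ₁ ℓ₂} →
         QuasiEmbedding Y Z → QuasiEmbedding X Y → QuasiEmbedding X Z
  g ∘ᵠ f = record
    { func     = func g ∘ᶠ func f
    ; reflects = QuasiEmbedding.reflects f ∘ QuasiEmbedding.reflects g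
    }

  infix 4 _≗ᵠ_
  _≗ᵠ_ : {X Y : Poset c ℓ₁ ℓ₂} → QuasiEmbedding X Y → QuasiEmbedding X Y → Set (c ⊔ ℓ₁)
  f ≗ᵠ g = func f ≗ func g

module _ (c ℓ₁ ℓ₂ : Level) where

  -- Endofunctors of PO.  Since equality of morphisms is _≗ᵠ_, being a function
  -- on morphisms includes respecting it (F-resp-≗).
  record POFunctor : Set (suc (c ⊔ ℓ₁ ⊔ ℓ₂)) where
    field
      F₀           : Poset c ℓ₁ ℓ₂ → Poset c ℓ₁ ℓ₂
      F₁           : ∀ {X Y} → QuasiEmbedding X Y → QuasiEmbedding (F₀ X) (F₀ Y)
      F-resp-≗     : ∀ {X Y} {f g : QuasiEmbedding X Y} → f ≗ᵠ g → F₁ f ≗ᵠ F₁ g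
      identity     : ∀ {X} → F₁ (idᵠ {X = X}) ≗ᵠ idᵠ
      homomorphism : ∀ {X Y Z} {f : QuasiEmbedding X Y} {g : QuasiEmbedding Y Z} →
                     F₁ (g ∘ᵠ f) ≗ᵠ F₁ g ∘ᵠ F₁ f

  record PODilator : Set (suc (c ⊔ ℓ₁ ⊔ ℓ₂)) where
    field
      functor : POFunctor
    open POFunctor functor public
    field
      preserves-embeddings :
        ∀ {X Y} (f : QuasiEmbedding X Y) → IsEmbedding f → IsEmbedding (F₁ f)
      supp         : ∀ X → Func ∣ F₀ X ∣ [ ∣ X ∣ ]^<ω
      supp-natural : ∀ {X Y} (f : QuasiEmbedding X Y) →
                     supp Y ∘ᶠ func (F₁ f) ≗ map^<ω (func f) ∘ᶠ supp X
      supp-range   : ∀ {X Y} (f : QuasiEmbedding X Y) → IsEmbedding f →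
                     rng (func (F₁ f)) ≐
                     (λ σ → (λ y → Membership._∈_ ∣ Y ∣ y (supp Y ⟨$⟩ σ)) ⊆ rng (func f))

module _ {c ℓ₁ ℓ₂ : Level} where

  IsNormal : PODilator c ℓ₁ ℓ₂ → Set (suc (c ⊔ ℓ₁ ⊔ ℓ₂))
  IsNormal W = ∀ X {σ τ} → Poset._≤_ (F₀ X) σ τ →
               (supp X ⟨$⟩ σ) ≤fin[ X ] (supp X ⟨$⟩ τ)
    where open PODilator W

  record NaturalIsomorphism (F G : POFunctor c ℓ₁ ℓ₂) : Set (suc (c ⊔ ℓ₁ ⊔ ℓ₂)) where
    private
      module F = POFunctor F
      module G = POFunctor G
    field
      η       : ∀ X → QuasiEmbedding (F.F₀ X) (G.F₀ X)
      natural : ∀ {X Y} (f : QuasiEmbedding X Y) → η Y ∘ᵠ F.F₁ f ≗ᵠ G.F₁ f ∘ᵠ η X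
      η⁻¹     : ∀ X → QuasiEmbedding (G.F₀ X) (F.F₀ X)
      isoˡ    : ∀ X → η⁻¹ X ∘ᵠ η X ≗ᵠ idᵠ
      isoʳ    : ∀ X → η X ∘ᵠ η⁻¹ X ≗ᵠ idᵠ

  module _ (W : PODilator c ℓ₁ ℓ₂) where
    private
      module W = PODilator W

    record IsKruskalFixedPoint (X Z : Poset c ℓ₁ ℓ₂)
                               (ι : Func ∣ X ∣ ∣ Z ∣) (κ : Func ∣ W.F₀ Z ∣ ∣ Z ∣) :
                               Set (c ⊔ ℓ₁ ⊔ ℓ₂) where
      private
        module X  = Poset X
        module Z  = Poset Z
        module WZ = Poset (W.F₀ Z)
      field
        disjoint : rng ι ∩ rng κ ⊆ ∅
        ι≤ι⇒     : ∀ x y → (ι ⟨$⟩ x) Z.≤ (ι ⟨$⟩ y) → x X.≤ y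
        ι≤κ⇔     : ∀ x τ → ((ι ⟨$⟩ x) Z.≤ (κ ⟨$⟩ τ)) ⇔
                           ([ ι ⟨$⟩ x ] ≤fin[ Z ] (W.supp Z ⟨$⟩ τ))
        κ≰ι      : ∀ σ y → ¬ ((κ ⟨$⟩ σ) Z.≤ (ι ⟨$⟩ y))
        κ≤κ⇔     : ∀ σ τ → ((κ ⟨$⟩ σ) Z.≤ (κ ⟨$⟩ τ)) ⇔
                           (σ WZ.≤ τ ⊎ [ κ ⟨$⟩ σ ] ≤fin[ Z ] (W.supp Z ⟨$⟩ τ))

    IsInitialKruskalFixedPoint : (X Z : Poset c ℓ₁ ℓ₂) →
      Func ∣ X ∣ ∣ Z ∣ → Func ∣ W.F₀ Z ∣ ∣ Z ∣ → Set (suc (c ⊔ ℓ₁ ⊔ ℓ₂))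
    IsInitialKruskalFixedPoint X Z ι κ =
      IsKruskalFixedPoint X Z ι κ ×
      (∀ (Z′ : Poset c ℓ₁ ℓ₂) (ι′ : Func ∣ X ∣ ∣ Z′ ∣) (κ′ : Func ∣ W.F₀ Z′ ∣ ∣ Z′ ∣) →
       IsKruskalFixedPoint X Z′ ι′ κ′ →
       ∃! _≗ᵠ_ λ (f : QuasiEmbedding Z Z′) →
         (func f ∘ᶠ ι ≗ ι′) × (func f ∘ᶠ κ ≗ κ′ ∘ᶠ func (W.F₁ f)))

    record KruskalDerivative : Set (suc (c ⊔ ℓ₁ ⊔ ℓ₂)) where
      field
        T      : PODilator c ℓ₁ ℓ₂
        normal : IsNormal T
      open PODilator T public using (F₀; F₁; functor)
      field
        ι         : ∀ X → Func ∣ X ∣ ∣ F₀ X ∣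
        κ         : ∀ X → Func ∣ W.F₀ (F₀ X) ∣ ∣ F₀ X ∣
        initial   : ∀ X → IsInitialKruskalFixedPoint X (F₀ X) (ι X) (κ X)
        ι-natural : ∀ {X Y} (f : QuasiEmbedding X Y) →
                    ι Y ∘ᶠ func f ≗ func (F₁ f) ∘ᶠ ι X
        κ-natural : ∀ {X Y} (f : QuasiEmbedding X Y) →
                    func (F₁ f) ∘ᶠ κ X ≗ κ Y ∘ᶠ func (W.F₁ (F₁ f))

{-# OPTIONS --safe #-}
module Submission where

-- By initiality there is a unique Kruskal morphism η_X : T⁰X → T¹X, invertible
-- by the usual argument.  For a quasi embedding f : X → Y, the fixed point T¹Y
-- over Y is also one over X, via ι_Y ∘ f.  Both composites in the naturality
-- square of f are Kruskal morphisms over X from the initial T⁰X to it, so they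
-- agree.

open import Defs
open import Data.Product using (Σ; _×_; _,_; proj₁; proj₂)
open import Function.Bundles using (Func; _⟨$⟩_)
open import Level using (_⊔_; suc)
open import Relation.Binary.Bundles using (Poset)

module _ {c ℓ₁ ℓ₂} (W : PODilator c ℓ₁ ℓ₂) where
  private
    module W = PODilator W

  -- Only the raw data: being a fixed point is a separate predicate, so that the base order can be
  -- changed and morphisms composed before any order condition has to be checked.
  record KruskalAlgebra (X : Poset c ℓ₁ ℓ₂) : Set (suc (c ⊔ ℓ₁ ⊔ ℓ₂)) where
    constructor kruskalAlgebra
    field
      Z : Poset c ℓ₁ ℓ₂
      ι : Func ∣ X ∣ ∣ Z ∣
      κ : Func ∣ W.F₀ Z ∣ ∣ Z ∣

  open KruskalAlgebra using (Z)

  IsFixedPoint : ∀ {X} → KruskalAlgebra X → Set _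
  IsFixedPoint {X} (kruskalAlgebra Z ι κ) = IsKruskalFixedPoint W X Z ι κ

  IsInitial : ∀ {X} → KruskalAlgebra X → Set _
  IsInitial {X} (kruskalAlgebra Z ι κ) = IsInitialKruskalFixedPoint W X Z ι κ

  record IsKruskalMorphism {X} (A B : KruskalAlgebra X)
                           (f : QuasiEmbedding (Z A) (Z B)) : Set (c ⊔ ℓ₁) where
    constructor _,_
    private
      module A = KruskalAlgebra A
      module B = KruskalAlgebra B
    field
      preserves-ι : func f ∘ᶠ A.ι ≗ B.ι
      preserves-κ : func f ∘ᶠ A.κ ≗ B.κ ∘ᶠ func (W.F₁ f)

  open IsKruskalMorphism

  idᵠ-isKruskalMorphism : ∀ {X} (A : KruskalAlgebra X) → IsKruskalMorphism A A idᵠ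
  idᵠ-isKruskalMorphism (kruskalAlgebra Z ι κ) =
    (λ _ → refl) , λ σ → sym (Func.cong κ (W.identity σ))
    where open Poset.Eq Z using (refl; sym)

  ∘ᵠ-isKruskalMorphism : ∀ {X} {A B C : KruskalAlgebra X}
    {g : QuasiEmbedding (Z B) (Z C)} {f : QuasiEmbedding (Z A) (Z B)} →
    IsKruskalMorphism B C g → IsKruskalMorphism A B f → IsKruskalMorphism A C (g ∘ᵠ f)
  ∘ᵠ-isKruskalMorphism {C = kruskalAlgebra Z ι κ} {g} {f} (gι , gκ) (fι , fκ) =
    (λ x → trans (Func.cong (func g) (fι x)) (gι x)) ,
    λ σ → trans (Func.cong (func g) (fκ σ))
      -- The `κ`-equation of `g` is taken at the image of `σ` under `W.F₁ f`; functoriality of `W`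
      -- then merges the two actions under `κ`.
      (trans (gκ _) (sym (Func.cong κ (W.homomorphism {f = f} {g = g} σ))))
    where open Poset.Eq Z using (sym; trans)

  -- Both morphisms agree with the mediating one that initiality supplies, hence with each other.
  initial⇒unique : ∀ {X} {A B : KruskalAlgebra X} → IsInitial A → IsFixedPoint B →
    {f g : QuasiEmbedding (Z A) (Z B)} →
    IsKruskalMorphism A B f → IsKruskalMorphism A B g → f ≗ᵠ g
  initial⇒unique {B = kruskalAlgebra Z ι κ} (_ , init) fp {f} {g} (fι , fκ) (gι , gκ) z =
    let _ , _ , unique = init Z ι κ fp
    in trans (sym (unique {f} (fι , fκ) z)) (unique {g} (gι , gκ) z)
    where open Poset.Eq Z using (sym; trans)

  restrict : ∀ {X Y} → QuasiEmbedding X Y → KruskalAlgebra Y → KruskalAlgebra X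
  restrict f (kruskalAlgebra Z ι κ) = kruskalAlgebra Z (ι ∘ᶠ func f) κ

  -- Precomposing `ι` with `f` only specialises the axioms to elements of the form `f x`, except for
  -- `ι≤ι⇒`, which refers to the order of the base: there the comparison in `Y` must be pulled back
  -- to `X`, and a quasi embedding does exactly this.
  restrict-isFixedPoint : ∀ {X Y} (f : QuasiEmbedding X Y) {A : KruskalAlgebra Y} →
    IsFixedPoint A → IsFixedPoint (restrict f A)
  restrict-isFixedPoint f fp = record
    { disjoint = λ ((x , p) , q) → disjoint ((func f ⟨$⟩ x , p) , q)
    ; ι≤ι⇒     = λ _ _ p → QuasiEmbedding.reflects f (ι≤ι⇒ _ _ p)
    ; ι≤κ⇔     = λ x → ι≤κ⇔ (func f ⟨$⟩ x)
    ; κ≰ι      = λ σ y → κ≰ι σ (func f ⟨$⟩ y)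
    ; κ≤κ⇔     = κ≤κ⇔
    }
    where open IsKruskalFixedPoint fp

  restrict-isKruskalMorphism : ∀ {X Y} (f : QuasiEmbedding X Y) {A B : KruskalAlgebra Y}
    {h : QuasiEmbedding (Z A) (Z B)} →
    IsKruskalMorphism A B h → IsKruskalMorphism (restrict f A) (restrict f B) h
  restrict-isKruskalMorphism f (hι , hκ) = (λ x → hι (func f ⟨$⟩ x)) , hκ

  module _ (T : KruskalDerivative W) where
    open KruskalDerivative T

    algebra : ∀ X → KruskalAlgebra X
    algebra X = kruskalAlgebra (F₀ X) (ι X) (κ X)

    -- This is the naturality of `ι` and `κ` read as a statement about morphisms over the single
    -- base `X`, which puts `F₁ f` within reach of initiality.
    F₁-isKruskalMorphism : ∀ {X Y} (f : QuasiEmbedding X Y) →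
      IsKruskalMorphism (algebra X) (restrict f (algebra Y)) (F₁ f)
    F₁-isKruskalMorphism {Y = Y} f =
      (λ x → Poset.Eq.sym (F₀ Y) (ι-natural f x)) , κ-natural f

  module _ (T⁰ T¹ : KruskalDerivative W) where
    private
      module T⁰ = KruskalDerivative T⁰
      module T¹ = KruskalDerivative T¹

    compare : ∀ X → QuasiEmbedding (T⁰.F₀ X) (T¹.F₀ X)
    compare X = proj₁ (proj₂ (T⁰.initial X) _ _ _ (proj₁ (T¹.initial X)))

    compare-isKruskalMorphism : ∀ X →
      IsKruskalMorphism (algebra T⁰ X) (algebra T¹ X) (compare X)
    compare-isKruskalMorphism X =
      let _ , (p , q) , _ = proj₂ (T⁰.initial X) _ _ _ (proj₁ (T¹.initial X))
      in p , q

    compare-natural : ∀ {X Y} (f : QuasiEmbedding X Y) →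
      compare Y ∘ᵠ T⁰.F₁ f ≗ᵠ T¹.F₁ f ∘ᵠ compare X
    compare-natural {X} {Y} f = initial⇒unique {A = algebra T⁰ X}
      (T⁰.initial X) (restrict-isFixedPoint f (proj₁ (T¹.initial Y)))
      (∘ᵠ-isKruskalMorphism
        -- The comparison at `Y` lives over `Y`; restricted along `f`, it starts at the algebra over
        -- `X` in which `T⁰.F₁ f` ends.
        (restrict-isKruskalMorphism f (compare-isKruskalMorphism Y))
        (F₁-isKruskalMorphism T⁰ f))
      (∘ᵠ-isKruskalMorphism
        (F₁-isKruskalMorphism T¹ f) (compare-isKruskalMorphism X))

  -- The round trip and the identity are both endomorphisms of an initial algebra. Quantifying over
  -- both derivatives lets the swapped instance give the other inverse law.
  compare-inverse : (T⁰ T¹ : KruskalDerivative W) → ∀ X →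
    compare T¹ T⁰ X ∘ᵠ compare T⁰ T¹ X ≗ᵠ idᵠ
  compare-inverse T⁰ T¹ X = initial⇒unique {A = algebra T⁰ X} initial (proj₁ initial)
    (∘ᵠ-isKruskalMorphism
      (compare-isKruskalMorphism T¹ T⁰ X) (compare-isKruskalMorphism T⁰ T¹ X))
    (idᵠ-isKruskalMorphism _)
    where initial = KruskalDerivative.initial T⁰ X

theorem4p4 : ∀ {c ℓ₁ ℓ₂} (W : PODilator c ℓ₁ ℓ₂) → IsNormal W →
    (T⁰ T¹ : KruskalDerivative W) →
    let module W  = PODilator W
        module T⁰ = KruskalDerivative T⁰
        module T¹ = KruskalDerivative T¹
    in Σ (NaturalIsomorphism T⁰.functor T¹.functor) λ iso →
         let open NaturalIsomorphism iso using (η)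
         in ∀ (X : Poset c ℓ₁ ℓ₂) →
              (func (η X) ∘ᶠ T⁰.ι X ≗ T¹.ι X) ×
              (func (η X) ∘ᶠ T⁰.κ X ≗ T¹.κ X ∘ᶠ func (W.F₁ (η X)))
theorem4p4 W _ T⁰ T¹ = iso , λ X →
  let open IsKruskalMorphism (compare-isKruskalMorphism W T⁰ T¹ X)
  in preserves-ι , preserves-κ
  where
  iso = record
    { η       = compare W T⁰ T¹
    ; natural = compare-natural W T⁰ T¹
    ; η⁻¹     = compare W T¹ T⁰
    ; isoˡ    = compare-inverse W T⁰ T¹
    ; isoʳ    = compare-inverse W T¹ T⁰
    }
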